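{- Let $m,g,t\ge 1$ be integers. Under the identification of a ruler $(x_0,\dots,x_m)$ with its vector of successive differences $\mathbf{z}=(z_1,\dots,z_m)$, $z_i=x_i-x_{i-1}$, the $B_2[g]$-sets with $m+1$ markings and length $t$ are in bijection with the lattice points (points of $\mathbb{Z}^m$) in the interior of $t\Delta_{m-1}$ that are not contained in any subspace of the form $$\sum_{i=r_g+1}^{r_0}z_i=\sum_{i=\ell_0+1}^{\ell_1}z_i+\sum_{i=r_g+1}^{r_1}z_i=\cdots=\sum_{i=\ell_0+1}^{\ell_k}z_i+\sum_{i=r_g+1}^{r_k}z_i=\cdots=\sum_{i=\ell_0+1}^{\ell_g}z_i,$$ where the indices satisfy $$0\le\ell_0<\ell_1<\cdots<\ell_g\le r_g<r_{g-1}<\cdots<r_0\le m.$$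
   Context: A ruler of length $t$ with $m+1$ markings is a sequence of integers $0=x_0<x_1<\cdots<x_{m-1}<x_m=t$. It is a $B_2[g]$-set if each positive integer admits at most $g$ representations as a sum of two markings. Representations are unordered and the two markings may be equal: a representation of $n$ is a pair of indices $i\le j$ with $x_i+x_j=n$. $\Delta_{m-1}=\{\mathbf{z}\in\mathbb{R}^m: z_1,\dots,z_m\ge 0,\ \sum_{i=1}^m z_i=1\}$. The interior of $t\Delta_{m-1}$ means its relative interior, $\{\mathbf{z}: z_i>0\text{ for all }i,\ \sum_i z_i=t\}$. Empty sums are $0$. -}

module Defs where

open import Data.Bool using (if_then_else_)
open import Data.Fin as Fin using (Fin; zero; suc; inject₁; fromℕ)
open import Data.Integer using (ℤ; +_; 0ℤ; _+_; _-_; _<_; _≟_)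
open import Data.Integer.Properties using (+-0-commutativeMonoid)
open import Data.List using (List; allFin; cartesianProduct; filter; length)
open import Data.Nat as ℕ using (ℕ; suc)
open import Data.Product using (Σ-syntax; _×_; _,_; proj₁)
open import Data.Vec.Functional using (Vector)
import Data.Vec.Functional.Relation.Binary.Equality.Setoid as VecEq
open import Level using (0ℓ)
open import Relation.Binary.Bundles using (Setoid)
import Relation.Binary.Construct.On as On
open import Relation.Binary.PropositionalEquality using (_≡_; setoid)
open import Relation.Nullary using (¬_; Dec; does; _×-dec_)

open import Algebra.Properties.CommutativeMonoid.Sum +-0-commutativeMonoid using (sum)

record IsRuler (m t : ℕ) (x : Vector ℤ (suc m)) : Set where
  field
    starts-at-0 : x zero ≡ 0ℤ
    increasing  : ∀ (i : Fin m) → x (inject₁ i) < x (suc i)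
    ends-at-t   : x (fromℕ m) ≡ + t

IsRepresentation : ∀ {k} → Vector ℤ k → ℤ → Fin k × Fin k → Set
IsRepresentation x n (i , j) = (i Fin.≤ j) × (x i + x j ≡ n)

isRepresentation? : ∀ {k} (x : Vector ℤ k) n p → Dec (IsRepresentation x n p)
isRepresentation? x n (i , j) = (i Fin.≤? j) ×-dec (x i + x j ≟ n)

-- Lists every representation exactly once, so its length is their number.
representations : ∀ {k} → Vector ℤ k → ℤ → List (Fin k × Fin k)
representations {k} x n =
  filter (isRepresentation? x n) (cartesianProduct (allFin k) (allFin k))

IsB₂[_] : ℕ → ∀ {k} → Vector ℤ k → Set
IsB₂[ g ] x = ∀ (n : ℤ) → 0ℤ < n → length (representations x n) ℕ.≤ g

differences : ∀ {m} → Vector ℤ (suc m) → Vector ℤ m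
differences x i = x (suc i) - x (inject₁ i)

-- The integer points of the relative interior of t Δ_{m-1}.
InteriorLatticePoint : (m t : ℕ) → Vector ℤ m → Set
InteriorLatticePoint m t z = (∀ i → 0ℤ < z i) × (sum z ≡ + t)

-- z_{a+1} + ⋯ + z_b.  The entry written z_1, …, z_m is z i with i : Fin m
-- counted from 0, so its 1-based index is suc i : Fin (suc m).
sumBetween : ∀ {m} → Fin (suc m) → Fin (suc m) → Vector ℤ m → ℤ
sumBetween a b z =
  sum (λ i → if does ((a Fin.<? suc i) ×-dec (suc i Fin.≤? b)) then z i else 0ℤ)

-- 0 ≤ ℓ_0 < ⋯ < ℓ_g ≤ r_g < ⋯ < r_0 ≤ m; the outer bounds are in the type.
record Admissible {m g : ℕ} (ℓ r : Fin (suc g) → Fin (suc m)) : Set where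
  field
    ℓ-increasing : ∀ (k : Fin g) → ℓ (inject₁ k) Fin.< ℓ (suc k)
    ℓ≤r          : ℓ (fromℕ g) Fin.≤ r (fromℕ g)
    r-decreasing : ∀ (k : Fin g) → r (suc k) Fin.< r (inject₁ k)

-- The k-th member of the chain of equations.  For k = 0 the first sum is
-- empty, and for k = g the second one is.
chainTerm : ∀ {m g} → (ℓ r : Fin (suc g) → Fin (suc m)) → Vector ℤ m → Fin (suc g) → ℤ
chainTerm {g = g} ℓ r z k =
  sumBetween (ℓ zero) (ℓ k) z + sumBetween (r (fromℕ g)) (r k) z

InSubspace : ∀ {m g} → (ℓ r : Fin (suc g) → Fin (suc m)) → Vector ℤ m → Set
InSubspace {g = g} ℓ r z =
  ∀ (k : Fin g) → chainTerm ℓ r z (inject₁ k) ≡ chainTerm ℓ r z (suc k)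

AvoidsSubspaces : (m g : ℕ) → Vector ℤ m → Set
AvoidsSubspaces m g z =
  ∀ (ℓ r : Fin (suc g) → Fin (suc m)) → Admissible ℓ r → ¬ InSubspace ℓ r z

B₂Ruler : (m g t : ℕ) → Set
B₂Ruler m g t = Σ[ x ∈ Vector ℤ (suc m) ] IsRuler m t x × IsB₂[ g ] x

AvoidingLatticePoint : (m g t : ℕ) → Set
AvoidingLatticePoint m g t =
  Σ[ z ∈ Vector ℤ m ] InteriorLatticePoint m t z × AvoidsSubspaces m g z

-- Elements of both setoids below are compared as integer vectors, ignoring
-- the accompanying proofs.
B₂Rulers : (m g t : ℕ) → Setoid 0ℓ 0ℓ
B₂Rulers m g t =
  On.setoid (VecEq.≋-setoid (setoid ℤ) (suc m)) (λ (x : B₂Ruler m g t) → proj₁ x)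

AvoidingLatticePoints : (m g t : ℕ) → Setoid 0ℓ 0ℓ
AvoidingLatticePoints m g t =
  On.setoid (VecEq.≋-setoid (setoid ℤ) m) (λ (z : AvoidingLatticePoint m g t) → proj₁ z)

{-# OPTIONS --safe #-}
-- Summing differences telescopes, so the k-th member of the chain of equations
-- is x(ℓ_k) + x(r_k) minus a constant: a subspace contains z exactly when the
-- g + 1 pairs (ℓ_k , r_k) represent one and the same integer, which is positive
-- since r_0 > 0.  Conversely, as x is strictly increasing, representations of a
-- fixed integer listed by increasing first index have decreasing second index,
-- so any g + 1 of them are nested pairs, that is, an admissible choice of
-- indices.
module Submission where

open import Defs
open import Data.Fin as Fin using (Fin; zero; suc; inject₁; fromℕ; inject≤)
open import Data.Fin.Properties as Finₚ using (toℕ-injective; toℕ-inject≤; toℕ-inject₁; injective⇒≤)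
open import Data.Integer as ℤ using (ℤ; 0ℤ; _+_; _-_)
open import Data.Integer.Properties as ℤₚ using (+-0-commutativeMonoid)
open import Data.Integer.Tactic.RingSolver using (solve-∀)
open import Data.List using (List; []; _∷_; allFin; cartesianProduct; length; lookup)
open import Data.List.Membership.Propositional using (_∈_)
open import Data.List.Membership.Propositional.Properties
  using (∈-filter⁺; ∈-filter⁻; ∈-cartesianProduct⁺; ∈-cartesianProduct⁻; ∈-allFin; ∈-lookup)
open import Data.List.Relation.Unary.All as All using ()
open import Data.List.Relation.Unary.All.Properties as Allₚ using ()
open import Data.List.Relation.Unary.AllPairs as AllPairs using (AllPairs; []; _∷_)
open import Data.List.Relation.Unary.AllPairs.Properties as AllPairsₚ using ()
open import Data.List.Relation.Unary.Any using (index)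
open import Data.List.Relation.Unary.Any.Properties using (lookup-index)
open import Data.Nat as ℕ using (ℕ; zero; suc; _≤_; z≤n; s≤s; s<s)
open import Data.Nat.Properties as ℕₚ using ()
open import Data.Product using (Σ-syntax; _×_; _,_; proj₁; proj₂)
open import Data.Product.Relation.Binary.Lex.Strict using (×-Lex)
open import Data.Sum using (inj₁; inj₂)
open import Data.Vec.Functional using (Vector; tail)
open import Function using (_∘_; flip)
open import Function.Bundles using (Bijection)
open import Relation.Binary.Core using (Rel)
open import Relation.Binary.Definitions using (Transitive; tri<; tri≈; tri>)
open import Relation.Binary.PropositionalEquality
  using (_≡_; refl; sym; trans; cong; cong₂; subst; subst₂; _≗_; module ≡-Reasoning)
open import Relation.Nullary using (yes; no; contradiction)

open import Algebra.Properties.CommutativeMonoid.Sum +-0-commutativeMonoid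
  using (sum; sum-replicate-zero)
open import Algebra.Properties.AbelianGroup ℤₚ.+-0-abelianGroup using () renaming (∙-cancelʳ to +-cancelʳ)

-- Monotone sequences and ordered lists.

consecutive⇒monotone : ∀ {a r} {A : Set a} (R : Rel A r) → Transitive R →
  ∀ {n} (f : Fin (suc n) → A) → (∀ k → R (f (inject₁ k)) (f (suc k))) →
  ∀ {i j} → i Fin.< j → R (f i) (f j)
consecutive⇒monotone R R-trans f step {zero} {suc zero} _ = step zero
consecutive⇒monotone R R-trans f step {zero} {suc (suc j)} _ =
  R-trans (step zero)
    (consecutive⇒monotone R R-trans (f ∘ suc) (step ∘ suc) {zero} {suc j} ℕ.z<s)
consecutive⇒monotone R R-trans {suc n} f step {suc i} {suc j} (s<s i<j) =
  consecutive⇒monotone R R-trans (f ∘ suc) (step ∘ suc) i<j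

StrictlyIncreasing : ∀ {k} → Vector ℤ k → Set
StrictlyIncreasing x = ∀ {i j} → i Fin.< j → x i ℤ.< x j

increasing⇒monotone : ∀ {k} {x : Vector ℤ k} → StrictlyIncreasing x →
  ∀ {i j} → i Fin.≤ j → x i ℤ.≤ x j
increasing⇒monotone {x = x} x↑ i≤j with ℕₚ.m≤n⇒m<n∨m≡n i≤j
... | inj₁ i<j = ℤₚ.<⇒≤ (x↑ i<j)
... | inj₂ i≡j = ℤₚ.≤-reflexive (cong x (toℕ-injective i≡j))

module _ {a r} {A : Set a} {R : Rel A r} where

  AllPairs-lookup : ∀ {xs} → AllPairs R xs →
    ∀ {i j} → i Fin.< j → R (lookup xs i) (lookup xs j)
  AllPairs-lookup {_ ∷ xs} (px ∷ _) {zero} {suc j} _ = All.lookup px (∈-lookup {xs = xs} j)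
  AllPairs-lookup (_ ∷ pxs) {suc i} {suc j} (s<s i<j) = AllPairs-lookup pxs i<j

  -- The product is a concatenation of blocks, one per element of `xs`: within a block the first
  -- component is constant and `S` decides, across blocks `R` does.
  AllPairs-cartesianProduct⁺ : ∀ {b s} {B : Set b} {S : Rel B s} {xs ys} →
    AllPairs R xs → AllPairs S ys → AllPairs (×-Lex _≡_ R S) (cartesianProduct xs ys)
  AllPairs-cartesianProduct⁺ [] _ = []
  AllPairs-cartesianProduct⁺ {xs = _ ∷ xs} {ys} (px ∷ pxs) pys = AllPairsₚ.++⁺
    (AllPairsₚ.map⁺ (AllPairs.map (λ s → inj₂ (refl , s)) pys))
    (AllPairs-cartesianProduct⁺ pxs pys)
    (Allₚ.map⁺ (All.tabulate λ _ → All.tabulate λ q∈ →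
      inj₁ (All.lookup px (proj₁ (∈-cartesianProduct⁻ xs ys q∈)))))

-- Representations in lexicographic order, and counting them.

∈-representations⁺ : ∀ {k} (x : Vector ℤ k) {n p} →
  IsRepresentation x n p → p ∈ representations x n
∈-representations⁺ x {n} = ∈-filter⁺ (isRepresentation? x n)
  (∈-cartesianProduct⁺ (∈-allFin _) (∈-allFin _))

∈-representations⁻ : ∀ {k} (x : Vector ℤ k) {n p} →
  p ∈ representations x n → IsRepresentation x n p
∈-representations⁻ {k} x {n} p∈ = proj₂
  (∈-filter⁻ (isRepresentation? x n) {xs = cartesianProduct (allFin k) (allFin k)} p∈)

representations-lex : ∀ {k} (x : Vector ℤ k) n →
  AllPairs (×-Lex _≡_ Fin._<_ Fin._<_) (representations x n)
representations-lex x n = AllPairsₚ.filter⁺ (isRepresentation? x n)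
  (AllPairs-cartesianProduct⁺ (AllPairsₚ.tabulate⁺-< λ i<j → i<j)
                              (AllPairsₚ.tabulate⁺-< λ i<j → i<j))

-- A larger first index raises the first summand, so an equal sum forces the second index down. The
-- tie case of the lexicographic order is void: with equal first indices, a larger second index
-- would raise the sum.
lex⇒nested : ∀ {k} {x : Vector ℤ k} → StrictlyIncreasing x → ∀ {i j i′ j′} →
  x i + x j ≡ x i′ + x j′ → ×-Lex _≡_ Fin._<_ Fin._<_ (i , j) (i′ , j′) →
  i Fin.< i′ × j′ Fin.< j
lex⇒nested {x = x} x↑ {i} eq (inj₂ (refl , j<j′)) =
  contradiction (ℤₚ.+-monoʳ-< (x i) (x↑ j<j′)) (ℤₚ.<-irrefl eq)
lex⇒nested {x = x} x↑ {j = j} {j′ = j′} eq (inj₁ i<i′) with j′ Fin.<? j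
... | yes j′<j = i<i′ , j′<j
... | no  j′≮j = contradiction
  (ℤₚ.+-mono-<-≤ (x↑ i<i′) (increasing⇒monotone {x = x} x↑ (ℕₚ.≮⇒≥ j′≮j)))
  (ℤₚ.<-irrefl eq)

-- Equal positions in `xs` hold equal entries, so sending `i` to the position of `f i` is an
-- injection into `Fin (length xs)`.
injection⇒≤length : ∀ {a} {A : Set a} {n} {xs : List A} (f : Fin n → A) →
  (∀ {i j} → f i ≡ f j → i ≡ j) → (∀ i → f i ∈ xs) → n ≤ length xs
injection⇒≤length {xs = xs} f f-inj f∈ = injective⇒≤ {f = index ∘ f∈} λ {i} {j} eq →
  f-inj (trans (lookup-index (f∈ i))
        (trans (cong (lookup xs) eq) (sym (lookup-index (f∈ j)))))

-- Telescoping sums of differences.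

consecutive-cancel : ∀ p q r → (q - p) + (r - q) ≡ r - p
consecutive-cancel = solve-∀

sumBetween-refl : ∀ {m} (a : Fin (suc m)) (z : Vector ℤ m) → sumBetween a a z ≡ 0ℤ
sumBetween-refl {zero}  zero    z = refl
sumBetween-refl {suc m} zero    z = sum-replicate-zero (suc m)
-- For a successor `a` the guard on the first entry evaluates to false, so that entry contributes 0
-- and a shifted sum over `tail z` remains.
sumBetween-refl {suc m} (suc a) z =
  trans (ℤₚ.+-identityˡ _) (sumBetween-refl a (tail z))

-- Allowing any `z` pointwise equal to `differences x` covers both `differences x` itself and a
-- given point `z` with `x` its prefix sums, without function extensionality.
sumBetween-telescope : ∀ {m} {a b : Fin (suc m)} (x : Vector ℤ (suc m)) {z : Vector ℤ m} →
  z ≗ differences x → a Fin.≤ b → sumBetween a b z ≡ x b - x a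
sumBetween-telescope {a = zero} {zero} x {z} _ _ =
  trans (sumBetween-refl zero z) (sym (ℤₚ.+-inverseʳ (x zero)))
sumBetween-telescope {suc m} {zero} {suc b} x {z} z≗ _ = begin
  z zero + sumBetween zero b (tail z)
    ≡⟨ cong₂ _+_ (z≗ zero) (sumBetween-telescope (tail x) (z≗ ∘ suc) z≤n) ⟩
  (x (suc zero) - x zero) + (x (suc b) - x (suc zero))
    ≡⟨ consecutive-cancel (x zero) (x (suc zero)) (x (suc b)) ⟩
  x (suc b) - x zero ∎
  where open ≡-Reasoning
sumBetween-telescope {suc m} {suc a} {suc b} x {z} z≗ (s≤s a≤b) =
  trans (ℤₚ.+-identityˡ _) (sumBetween-telescope (tail x) (z≗ ∘ suc) a≤b)

sum-telescope : ∀ {m} (x : Vector ℤ (suc m)) {z : Vector ℤ m} →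
  z ≗ differences x → sum z ≡ x (fromℕ m) - x zero
sum-telescope {zero}  x _ = sym (ℤₚ.+-inverseʳ (x zero))
sum-telescope {suc m} x {z} z≗ =
  trans (cong₂ _+_ (z≗ zero) (sum-telescope (tail x) (z≗ ∘ suc)))
        (consecutive-cancel (x zero) (x (suc zero)) (x (fromℕ (suc m))))

-- Admissible index pairs and the subspaces they define.

module AdmissibleIndices {m g} {ℓ r : Fin (suc g) → Fin (suc m)} (adm : Admissible ℓ r) where
  open Admissible adm

  ℓ-mono-< : ∀ {i j} → i Fin.< j → ℓ i Fin.< ℓ j
  ℓ-mono-< = consecutive⇒monotone Fin._<_ Finₚ.<-trans ℓ ℓ-increasing

  r-anti-< : ∀ {i j} → i Fin.< j → r j Fin.< r i
  r-anti-< = consecutive⇒monotone (flip Fin._<_) (flip Finₚ.<-trans) r r-decreasing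

  ℓ-injective : ∀ {i j} → ℓ i ≡ ℓ j → i ≡ j
  ℓ-injective {i} {j} eq with Finₚ.<-cmp i j
  ... | tri≈ _ i≡j _ = i≡j
  ... | tri< i<j _ _ = contradiction (ℓ-mono-< i<j) (Finₚ.<-irrefl eq)
  ... | tri> _ _ j<i = contradiction (ℓ-mono-< j<i) (Finₚ.<-irrefl (sym eq))

  ℓ₀≤ℓ : ∀ k → ℓ zero Fin.≤ ℓ k
  ℓ₀≤ℓ zero    = ℕₚ.≤-refl
  ℓ₀≤ℓ (suc k) = ℕₚ.<⇒≤ (ℓ-mono-< ℕ.z<s)

  ℓ≤ℓ-last : ∀ k → ℓ k Fin.≤ ℓ (fromℕ g)
  ℓ≤ℓ-last k with ℕₚ.m≤n⇒m<n∨m≡n (Finₚ.≤fromℕ k)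
  ... | inj₁ k<g = ℕₚ.<⇒≤ (ℓ-mono-< k<g)
  ... | inj₂ k≡g = ℕₚ.≤-reflexive (cong (Fin.toℕ ∘ ℓ) (toℕ-injective k≡g))

  r-last≤r : ∀ k → r (fromℕ g) Fin.≤ r k
  r-last≤r k with ℕₚ.m≤n⇒m<n∨m≡n (Finₚ.≤fromℕ k)
  ... | inj₁ k<g = ℕₚ.<⇒≤ (r-anti-< k<g)
  ... | inj₂ k≡g = ℕₚ.≤-reflexive (cong (Fin.toℕ ∘ r) (sym (toℕ-injective k≡g)))

  -- Follows from ℓ_k ≤ ℓ_g ≤ r_g ≤ r_k. It supplies the ordering `i ≤ j` that a representation
  -- demands of its pair.
  ℓ≤r-at : ∀ k → ℓ k Fin.≤ r k
  ℓ≤r-at k = ℕₚ.≤-trans (ℓ≤ℓ-last k) (ℕₚ.≤-trans ℓ≤r (r-last≤r k))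

  chainTerm-telescope : ∀ (x : Vector ℤ (suc m)) {z} → z ≗ differences x → ∀ k →
    chainTerm ℓ r z k ≡ (x (ℓ k) + x (r k)) - (x (ℓ zero) + x (r (fromℕ g)))
  chainTerm-telescope x z≗ k = trans
    (cong₂ _+_ (sumBetween-telescope x z≗ (ℓ₀≤ℓ k)) (sumBetween-telescope x z≗ (r-last≤r k)))
    (regroup (x (ℓ k)) (x (ℓ zero)) (x (r k)) (x (r (fromℕ g))))
    where
    regroup : ∀ p q s t → (p - q) + (s - t) ≡ (p + s) - (q + t)
    regroup = solve-∀

  inSubspace⇒sameSum : ∀ (x : Vector ℤ (suc m)) {z} → z ≗ differences x →
    InSubspace ℓ r z → ∀ k → x (ℓ k) + x (r k) ≡ x (ℓ zero) + x (r zero)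
  inSubspace⇒sameSum x z≗ z∈ zero = refl
  inSubspace⇒sameSum x z≗ z∈ (suc k) = sym
    -- Equality is itself transitive, so the monotonicity lemma carries the equality of consecutive
    -- sums from index 0 to every later index.
    (consecutive⇒monotone _≡_ trans (λ j → x (ℓ j) + x (r j)) step {zero} {suc k} ℕ.z<s)
    where
    step : ∀ j → x (ℓ (inject₁ j)) + x (r (inject₁ j)) ≡ x (ℓ (suc j)) + x (r (suc j))
    -- The subtracted constant x(ℓ_0) + x(r_g) is the same for both indices and cancels.
    step j = +-cancelʳ _ _ _ (trans (sym (chainTerm-telescope x z≗ (inject₁ j)))
      (trans (z∈ j) (chainTerm-telescope x z≗ (suc j))))

  sameSum⇒inSubspace : ∀ (x : Vector ℤ (suc m)) {z n} → z ≗ differences x →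
    (∀ k → x (ℓ k) + x (r k) ≡ n) → InSubspace ℓ r z
  sameSum⇒inSubspace x z≗ same k = begin
    chainTerm ℓ r _ (inject₁ k) ≡⟨ chainTerm-telescope x z≗ (inject₁ k) ⟩
    _ ≡⟨ cong (_- _) (trans (same (inject₁ k)) (sym (same (suc k)))) ⟩
    _ ≡⟨ chainTerm-telescope x z≗ (suc k) ⟨
    chainTerm ℓ r _ (suc k) ∎
    where open ≡-Reasoning

-- The `B₂[g]` condition and avoidance of the subspaces.

B₂⇒avoids : ∀ {m g} → 1 ≤ g → (x : Vector ℤ (suc m)) {z : Vector ℤ m} → z ≗ differences x →
  x zero ≡ 0ℤ → StrictlyIncreasing x → IsB₂[ g ] x → AvoidsSubspaces m g z
B₂⇒avoids {g = suc g} _ x z≗ x₀≡0 x↑ x-B₂ ℓ r adm z∈ =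
  ℕₚ.<⇒≱ (injection⇒≤length (λ k → ℓ k , r k) (ℓ-injective ∘ cong proj₁) pair∈) (x-B₂ n n>0)
  where
  open AdmissibleIndices adm
  n : ℤ
  n = x (ℓ zero) + x (r zero)
  n>0 : 0ℤ ℤ.< n
  -- Here x(ℓ_0) ≥ x(0) = 0, while r_0 > r_1 ≥ 0 gives x(r_0) > 0. The index r_1 exists because `g`
  -- is positive; for `g = 0` the only pair could be (0, 0), which represents 0.
  n>0 = subst (ℤ._< n) (cong₂ _+_ x₀≡0 x₀≡0)
    (ℤₚ.+-mono-≤-< (increasing⇒monotone {x = x} x↑ {zero} z≤n)
      (x↑ (ℕₚ.≤-<-trans z≤n (r-anti-< {zero} {suc zero} ℕ.z<s))))
  pair∈ : ∀ k → (ℓ k , r k) ∈ representations x n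
  pair∈ k = ∈-representations⁺ x (ℓ≤r-at k , inSubspace⇒sameSum x z≗ z∈ k)

avoids⇒B₂ : ∀ {m g} (x : Vector ℤ (suc m)) {z : Vector ℤ m} → z ≗ differences x →
  StrictlyIncreasing x → AvoidsSubspaces m g z → IsB₂[ g ] x
avoids⇒B₂ {m} {g} x z≗ x↑ avoids n _ = ℕₚ.≮⇒≥ λ g<length →
  let
    pair : Fin (suc g) → Fin (suc m) × Fin (suc m)
    -- The first g + 1 entries of a list assumed to be longer than `g`.
    pair k = lookup (representations x n) (inject≤ k g<length)
    isRep : ∀ k → IsRepresentation x n (pair k)
    isRep k = ∈-representations⁻ x (∈-lookup (inject≤ k g<length))
    inject≤-step : ∀ k → inject≤ (inject₁ k) g<length Fin.< inject≤ (suc k) g<length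
    -- Both `inject≤` and `inject₁` preserve numerical values, so the claim is k < k + 1, which
    -- unfolds to reflexivity of ≤.
    inject≤-step k = subst₂ ℕ._<_
      (sym (trans (toℕ-inject≤ (inject₁ k) g<length) (toℕ-inject₁ k)))
      (sym (toℕ-inject≤ (suc k) g<length)) ℕₚ.≤-refl
    nested : ∀ k → _
    nested k = lex⇒nested {x = x} x↑
      (trans (proj₂ (isRep (inject₁ k))) (sym (proj₂ (isRep (suc k)))))
      (AllPairs-lookup (representations-lex x n) (inject≤-step k))
    adm : Admissible (proj₁ ∘ pair) (proj₂ ∘ pair)
    adm = record
      { ℓ-increasing = proj₁ ∘ nested
      ; ℓ≤r          = proj₁ (isRep (fromℕ g))
      ; r-decreasing = proj₂ ∘ nested
      }
  in avoids _ _ adm (AdmissibleIndices.sameSum⇒inSubspace adm x z≗ (proj₂ ∘ isRep))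

-- Recovering a ruler from its differences.

prefixSums : ∀ {m} → Vector ℤ m → Vector ℤ (suc m)
prefixSums z zero = 0ℤ
prefixSums {suc m} z (suc k) = z zero + prefixSums (tail z) k

differences-prefixSums : ∀ {m} (z : Vector ℤ m) → z ≗ differences (prefixSums z)
differences-prefixSums {suc m} z zero = sym (trans (ℤₚ.+-identityʳ _) (ℤₚ.+-identityʳ _))
-- Beyond index 0, prefix sums are those of the tail shifted by the constant `z zero`, which cancels
-- in each difference.
differences-prefixSums {suc m} z (suc i) =
  trans (differences-prefixSums (tail z) i)
        (shift (z zero) (prefixSums (tail z) (suc i)) (prefixSums (tail z) (inject₁ i)))
  where
  shift : ∀ c p q → p - q ≡ (c + p) - (c + q)
  shift = solve-∀

prefixSums-last : ∀ {m} (z : Vector ℤ m) → prefixSums z (fromℕ m) ≡ sum z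
prefixSums-last {zero}  z = refl
prefixSums-last {suc m} z = cong (z zero +_) (prefixSums-last (tail z))

-- The sum of the first k differences telescopes to x(k) - x(0), and equally to y(k) - y(0); the
-- common starting value then cancels.
differences-injective : ∀ {m} {x y : Vector ℤ (suc m)} → x zero ≡ y zero →
  differences x ≗ differences y → x ≗ y
differences-injective {x = x} {y} x₀≡y₀ dx≗dy k = +-cancelʳ _ _ _ (begin
  x k - x zero                        ≡⟨ sumBetween-telescope x (λ _ → refl) z≤n ⟨
  sumBetween zero k (differences x)   ≡⟨ sumBetween-telescope y dx≗dy z≤n ⟩
  y k - y zero                        ≡⟨ cong (λ c → y k - c) x₀≡y₀ ⟨
  y k - x zero                        ∎)
  where open ≡-Reasoning

-- Rulers as interior lattice points.

ruler⇒strictlyIncreasing : ∀ {m t x} → IsRuler m t x → StrictlyIncreasing x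
ruler⇒strictlyIncreasing {x = x} ruler =
  consecutive⇒monotone ℤ._<_ ℤₚ.<-trans x (IsRuler.increasing ruler)

ruler⇒interior : ∀ {m t x} → IsRuler m t x → InteriorLatticePoint m t (differences x)
ruler⇒interior {m} {x = x} ruler = positive , trans (sum-telescope x (λ _ → refl)) length-t
  where
  open IsRuler ruler
  positive : ∀ i → 0ℤ ℤ.< differences x i
  positive i = subst (ℤ._< differences x i) (ℤₚ.+-inverseʳ (x (inject₁ i)))
    (ℤₚ.+-monoˡ-< (ℤ.- x (inject₁ i)) (increasing i))
  length-t : x (fromℕ m) - x zero ≡ _
  length-t = trans (cong₂ _-_ ends-at-t starts-at-0) (ℤₚ.+-identityʳ _)

interior⇒ruler : ∀ {m t z} → InteriorLatticePoint m t z → IsRuler m t (prefixSums z)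
interior⇒ruler {z = z} (z>0 , sum≡t) = record
  { starts-at-0 = refl
  -- Each entry of `z` is a difference of neighbouring prefix sums; adding the earlier one to both
  -- sides of its positivity gives the increase.
  ; increasing  = λ i → subst₂ ℤ._<_ (ℤₚ.+-identityˡ _) (add-back _ _)
      (ℤₚ.+-monoˡ-< (prefixSums z (inject₁ i))
        (subst (0ℤ ℤ.<_) (differences-prefixSums z i) (z>0 i)))
  ; ends-at-t   = trans (prefixSums-last z) sum≡t
  }
  where
  add-back : ∀ p q → (p - q) + q ≡ p
  add-back = solve-∀

proposition3p6 : (m g t : ℕ) → 1 ≤ m → 1 ≤ g → 1 ≤ t →
    Σ[ φ ∈ Bijection (B₂Rulers m g t) (AvoidingLatticePoints m g t) ]
    (∀ (x : B₂Ruler m g t) (i : Fin m) →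
    proj₁ (Bijection.to φ x) i ≡ differences (proj₁ x) i)
proposition3p6 m g t _ 1≤g _ = φ , λ _ _ → refl
  where
  toPoint : B₂Ruler m g t → AvoidingLatticePoint m g t
  toPoint (x , ruler , x-B₂) = differences x , ruler⇒interior ruler ,
    B₂⇒avoids 1≤g x (λ _ → refl) (IsRuler.starts-at-0 ruler)
      (ruler⇒strictlyIncreasing ruler) x-B₂

  toRuler : AvoidingLatticePoint m g t → B₂Ruler m g t
  toRuler (z , interior , avoids) = prefixSums z , interior⇒ruler interior ,
    avoids⇒B₂ (prefixSums z) (differences-prefixSums z)
      (ruler⇒strictlyIncreasing (interior⇒ruler interior)) avoids

  φ : Bijection (B₂Rulers m g t) (AvoidingLatticePoints m g t)
  φ = record
    { to        = toPoint
    ; cong      = λ x≗y i → cong₂ _-_ (x≗y (suc i)) (x≗y (inject₁ i))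
    ; bijective =
        (λ {x} {y} → differences-injective
          (trans (IsRuler.starts-at-0 (proj₁ (proj₂ x)))
                 (sym (IsRuler.starts-at-0 (proj₁ (proj₂ y))))))
      -- Surjectivity between setoids asks that every ruler pointwise equal to the chosen preimage
      -- be sent to `z`, so `x≗` is first pushed through the differences.
      , λ z → toRuler z , λ x≗ i →
          trans (cong₂ _-_ (x≗ (suc i)) (x≗ (inject₁ i)))
                (sym (differences-prefixSums (proj₁ z) i))
    }
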